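{- For any mean payoff game with Maximizer vertices $V_{\max}=\{v_1,\dots,v_m\}$, the set $\Sigma$ of positional Maximizer strategies that guarantee a nonnegative long-term average outcome from every starting vertex forms an ample set of $U=N^+(v_1)\times N^+(v_2)\times\cdots\times N^+(v_m)$.
   Context: A mean payoff game is played by Maximizer and Minimizer on a finite directed graph $G=(V_{\max}\cup V_{\min},E)$ (with $V_{\max},V_{\min}$ disjoint, and every vertex having at least one outgoing edge), with a weight function $w:E\to\mathbb Z$. A pebble is placed on an initial vertex; at each step the owner of the current vertex chooses an outgoing edge along which the pebble moves, indefinitely. The outcome is the long-term average of the weights of the traversed edges (e.g. $\liminf_{n\to\infty}\frac1n\sum_{k=1}^n w(e_k)$), which Maximizer wants to maximize and Minimizer to minimize. $N^+(v)$ is the set of successors of $v$. A positional Maximizer strategy is a vector $\sigma\in N^+(v_1)\times\cdots\times N^+(v_m)$, meaning that Maximizer moves the pebble to $\sigma_i$ whenever it is on $v_i$. $\Sigma$ is the set of $\sigma$ such that for every starting vertex and all choices of Minimizer, the resulting outcome is $\ge 0$. The sets $N^+(v_i)$ may intersect. For a Cartesian product $U=U_1\times\cdots\times U_m$ of nonempty finite sets, a generalized partition is a tuple $\Lambda=(\alpha_1,\dots,\alpha_m)$ with $\alpha_i$ a partition of $U_i$ into nonempty blocks; it defines a partition of $U$ into the boxes $P^1\times\cdots\times P^m$, $P^i\in\alpha_i$, and the minor-subproduct $M(\Lambda)=M_1\times\cdots\times M_m$, where $M_i$ is the set of blocks of $\alpha_i$. $M(\Lambda)$ is shattered by $S\subseteq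 U$ if $S$ meets every box of the box-partition. A copy of $M(\Lambda)$ is a set $W_1\times\cdots\times W_m$ where $W_i$ consists of exactly one element from each block of $\alpha_i$. $M(\Lambda)$ is strongly shattered by $S$ if $S$ contains a copy of it. $S$ is ample if every minor-subproduct of $U$ shattered by $S$ is strongly shattered by $S$. -}

module Defs where

open import Data.Nat as ℕ using (ℕ; zero; suc)
open import Data.Integer as ℤ using (ℤ; 0ℤ)
open import Data.Rational as ℚ using (ℚ; 0ℚ; _/_)
open import Data.Fin using (Fin)
open import Data.Fin.Subset using (Subset; _∈_; Nonempty) renaming (_⊆_ to _⊆ₛ_)
open import Data.Vec using (Vec; lookup)
open import Data.Product using (_×_; ∃; ∃!)
open import Function.Bundles using (_⇔_)
open import Function.Definitions using (Injective)
open import Level using (0ℓ)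
open import Relation.Binary.PropositionalEquality using (_≡_)
open import Relation.Unary using (Pred; _⊆_; _≬_)

-- Blocks are indexed without repetition: `nonempty` and `disjoint` make
-- `block` injective, so `Fin size` stands for the set of blocks.
record Partition {n : ℕ} (A : Subset n) : Set where
  field
    size     : ℕ
    block    : Fin size → Subset n
    nonempty : ∀ j → Nonempty (block j)
    covers   : ∀ x → x ∈ A ⇔ (∃ λ j → x ∈ block j)
    disjoint : ∀ {x j j′} → x ∈ block j → x ∈ block j′ → j ≡ j′

open Partition public

module _ {m n : ℕ} where

  ∏ : (Fin m → Subset n) → Pred (Vec (Fin n) m) 0ℓ
  ∏ A σ = ∀ i → lookup σ i ∈ A i

  GeneralizedPartition : (Fin m → Subset n) → Set
  GeneralizedPartition U = ∀ i → Partition (U i)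

  module _ {U : Fin m → Subset n} where

    MinorSubproduct : GeneralizedPartition U → Set
    MinorSubproduct Λ = ∀ i → Fin (size (Λ i))

    box : (Λ : GeneralizedPartition U) → MinorSubproduct Λ → Pred (Vec (Fin n) m) 0ℓ
    box Λ P = ∏ λ i → block (Λ i) (P i)

    Shattered : GeneralizedPartition U → Pred (Vec (Fin n) m) 0ℓ → Set
    Shattered Λ S = ∀ (P : MinorSubproduct Λ) → S ≬ box Λ P

    IsCopy : GeneralizedPartition U → (Fin m → Subset n) → Set
    IsCopy Λ W = ∀ i → W i ⊆ₛ U i ×
                       (∀ j → ∃! _≡_ λ x → x ∈ W i × x ∈ block (Λ i) j)

    StronglyShattered : GeneralizedPartition U → Pred (Vec (Fin n) m) 0ℓ → Set
    StronglyShattered Λ S = ∃ λ W → IsCopy Λ W × ∏ W ⊆ S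

  Ample : (Fin m → Subset n) → Pred (Vec (Fin n) m) 0ℓ → Set
  Ample U S = S ⊆ ∏ U ×
              (∀ (Λ : GeneralizedPartition U) → Shattered Λ S → StronglyShattered Λ S)

-- c ≤ lim inf a, phrased without forming the (real) limit inferior.
_≤liminf_ : ℚ → (ℕ → ℚ) → Set
c ≤liminf a = ∀ ε → 0ℚ ℚ.< ε → ∃ λ N → ∀ t → N ℕ.≤ t → c ℚ.- ε ℚ.< a t

-- The vertices are Fin n; Maximizer owns exactly the vertices v i and
-- Minimizer owns all the others.
record MeanPayoffGame : Set where
  field
    n m         : ℕ
    v           : Fin m → Fin n
    v-injective : Injective _≡_ _≡_ v
    N⁺          : Fin n → Subset n
    N⁺-nonempty : ∀ u → Nonempty (N⁺ u)
    w           : ∀ {u u′} → u′ ∈ N⁺ u → ℤ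

module _ (G : MeanPayoffGame) where
  open MeanPayoffGame G

  record Play : Set where
    field
      position : ℕ → Fin n
      move     : ∀ t → position (suc t) ∈ N⁺ (position t)

module _ {G : MeanPayoffGame} where
  open MeanPayoffGame G
  open Play

  totalWeight : Play G → ℕ → ℤ
  totalWeight p zero    = 0ℤ
  totalWeight p (suc t) = totalWeight p t ℤ.+ w (move p t)

  -- Shifted by one to avoid dividing by zero: the mean of the first t + 1 weights.
  average : Play G → ℕ → ℚ
  average p t = totalWeight p (suc t) / suc t

  Follows : Play G → Vec (Fin n) m → Set
  Follows p σ = ∀ t i → position p t ≡ v i → position p (suc t) ≡ lookup σ i

module _ (G : MeanPayoffGame) where
  open MeanPayoffGame G

  strategySets : Fin m → Subset n
  strategySets i = N⁺ (v i)

  -- A starting vertex together with all of Minimizer's choices against σ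
  -- amounts to a play in which Maximizer follows σ.
  Winning : Pred (Vec (Fin n) m) 0ℓ
  Winning σ = ∏ strategySets σ ×
              (∀ (p : Play G) → Follows p σ → 0ℚ ≤liminf average p)

{-# OPTIONS --safe #-}
-- A potential for σ is a function π on the vertices with π u ≤ w(u , u′) + π u′ on
-- every edge that remains when Maximizer plays σ.  It bounds the total weight of every
-- play from below, so σ is winning if it has a potential, and the converse also holds.
--
-- Inequalities of this shape, and disjunctions of them that share the left-hand side
-- π u, survive adding a constant to π, and they survive increasing π away from u.
-- So if π₁, …, πₖ satisfy one such condition each, all at the same u, then after
-- normalising them to agree at u their pointwise maximum satisfies all k conditions,
-- while conditions common to all πⱼ, at whatever vertex, are kept.
--
-- Applied to Minimizer's choices, this reduces that converse to graphs with
-- one edge out of each vertex, where the least weight of a walk of length ≤ n is a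
-- potential.  Applied to Maximizer's blocks, it turns the potentials for the boxes of a
-- shattered minor-subproduct into one potential π such that every block of α_i contains
-- some x with π(v_i) ≤ w(v_i , x) + π x; these x form the copy.
module Submission where

open import Defs

open import Data.Fin using (Fin; zero; suc; toℕ; _≟_)
open import Data.Fin.Properties using (any?; all?; pigeonhole; toℕ<n)
open import Data.Fin.Subset using (Subset; _∈_)
open import Data.Fin.Subset.Properties using (_∈?_)
open import Data.Integer using (ℤ; +_; 0ℤ; 1ℤ; _+_; _-_; _*_; -_; _≤_; _<_; _⊔_; ∣_∣; -[1+_]; -1ℤ; +<+)
import Data.Integer.Properties as ℤ
open import Data.Integer.Tactic.RingSolver using (solve-∀)
import Data.List as List
open import Data.List.Extrema ℤ.≤-totalOrder using (min; max; min≤xs; v≤min⁺; xs≤max)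
import Data.List.Relation.Unary.All as All
import Data.List.Relation.Unary.All.Properties as All
open import Data.List.Membership.Propositional.Properties using (∈-allFin)
open import Data.Nat as ℕ using (ℕ; zero; suc; s≤s)
open import Data.Nat.Coprimality using (1-coprimeTo)
import Data.Nat.Properties as ℕ
open import Data.Product using (_×_; _,_; proj₁; proj₂; map₂; ∃; Σ)
open import Data.Rational as ℚ using (ℚ; mkℚ; 0ℚ; ↥_; ↧_; _/_)
import Data.Rational.Properties as ℚ
open import Data.Rational.Unnormalised as ℚᵘ using (mkℚᵘ)
import Data.Rational.Unnormalised.Properties as ℚᵘ
open import Data.Sum using (inj₁; inj₂)
open import Data.Unit using (tt)
open import Data.Vec using (Vec; lookup; tabulate)
open import Data.Vec.Properties using ([]=⇒lookup; lookup⇒[]=; lookup∘tabulate)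
open import Data.Vec.Properties.WithK using ([]=-irrelevant)
open import Function using (_∘_; id; _$_)
open import Function.Bundles using (_⇔_; mk⇔; module Equivalence)
open import Level using (0ℓ)
open import Relation.Binary.PropositionalEquality
open import Relation.Nullary using (yes; no; does; contradiction)
open import Relation.Nullary.Decidable using (_→-dec_; _×-dec_; dec-true)
open import Relation.Unary using (Pred; Decidable; Satisfiable; U; _∩_)

open Equivalence using (to; from)

-- Means of integer sequences

-- `x / suc t` is reduced to lowest terms, so the comparison passes through unnormalised rationals,
-- where it is cross-multiplication.
-ε<mean⇔ : ∀ ε x t → 0ℚ ℚ.- ε ℚ.< x / suc t ⇔ - ↥ ε * + suc t < x * ↧ ε
-ε<mean⇔ ε@record{} x t = mk⇔
  (λ lt → ℚᵘ.drop-*<* (ℚᵘ.<-respˡ-≃ -ε≃ (ℚᵘ.<-respʳ-≃ mean≃ (ℚ.toℚᵘ-mono-< lt))))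
  (λ lt → ℚ.toℚᵘ-cancel-< (ℚᵘ.<-respˡ-≃ (ℚᵘ.≃-sym -ε≃) (ℚᵘ.<-respʳ-≃ (ℚᵘ.≃-sym mean≃) (ℚᵘ.*<* lt))))
  where
  -ε≃ : ℚ.toℚᵘ (0ℚ ℚ.- ε) ℚᵘ.≃ ℚᵘ.- ℚ.toℚᵘ ε
  -ε≃ = ℚᵘ.≃-trans (ℚ.toℚᵘ-cong (ℚ.+-identityˡ (ℚ.- ε))) (ℚ.toℚᵘ-homo‿- ε)

  mean≃ : ℚ.toℚᵘ (x / suc t) ℚᵘ.≃ mkℚᵘ x t
  mean≃ = ℚ.toℚᵘ-fromℚᵘ (mkℚᵘ x t)

-∣i∣≤i : ∀ i → - + ∣ i ∣ ≤ i
-∣i∣≤i (+ _)    = ℤ.neg-≤-pos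
-∣i∣≤i -[1+ _ ] = ℤ.≤-refl

bounded⇒0≤liminf-mean : ∀ (s : ℕ → ℤ) l → (∀ t → l ≤ s t) →
                        0ℚ ≤liminf (λ t → s (suc t) / suc t)
-- The mean is at least `l / suc t`. For `t` from this witness on, `suc t` exceeds `∣ l * ↧ ε ∣`,
-- while `↥ ε` is at least 1.
bounded⇒0≤liminf-mean s l l≤s ε@record{} 0<ε = ∣ l * ↧ ε ∣ , λ t N≤t → from (-ε<mean⇔ ε (s (suc t)) t) $ begin-strict
  - ↥ ε * + suc t        ≤⟨ ℤ.*-monoʳ-≤-nonNeg (+ suc t) (ℤ.neg-mono-≤ (ℤ.i<j⇒suc[i]≤j 0<↥ε)) ⟩
  - 1ℤ * + suc t         ≡⟨ ℤ.-1*i≡-i (+ suc t) ⟩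
  - + suc t              <⟨ ℤ.neg-mono-< (+<+ (s≤s N≤t)) ⟩
  - + ∣ l * ↧ ε ∣        ≤⟨ -∣i∣≤i (l * ↧ ε) ⟩
  l * ↧ ε                ≤⟨ ℤ.*-monoʳ-≤-nonNeg (↧ ε) (l≤s (suc t)) ⟩
  s (suc t) * ↧ ε        ∎
  where
  open ℤ.≤-Reasoning
  0<↥ε : 0ℤ < ↥ ε
  0<↥ε = ℤ.positive⁻¹ (↥ ε) {{ℚ.positive 0<ε}}

-- At multiples of the period `suc L` the mean is `c / suc L`, which for negative `c` is at most -1
-- / `suc L`, arbitrarily late.
0≤liminf-mean⇒0≤period : ∀ (s : ℕ → ℤ) L c → (∀ k → s (k ℕ.* suc L) ≡ + k * c) →
                         0ℚ ≤liminf (λ t → s (suc t) / suc t) → 0ℤ ≤ c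
0≤liminf-mean⇒0≤period s L c periodic liminf with 0ℤ ℤ.≤? c
... | yes 0≤c = 0≤c
... | no  0≰c = contradiction mean≤-ε (ℤ.<⇒≱ -ε<mean)
  where
  open ℤ.≤-Reasoning

  ε : ℚ
  ε = mkℚ 1ℤ L (1-coprimeTo (suc L))

  N = proj₁ (liminf ε (ℚ.*<* (+<+ (s≤s ℕ.z≤n))))
  -- Chosen so that `suc t` is `suc N ℕ.* suc L` by computation.
  t = L ℕ.+ N ℕ.* suc L

  N≤t : N ℕ.≤ t
  N≤t = ℕ.≤-trans (ℕ.m≤m*n N (suc L)) (ℕ.m≤n+m (N ℕ.* suc L) L)

  -ε<mean : - 1ℤ * + suc t < s (suc t) * + suc L
  -ε<mean = to (-ε<mean⇔ ε (s (suc t)) t) (proj₂ (liminf ε _) t N≤t)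

  c≤-1 : c ≤ -1ℤ
  c≤-1 = ℤ.i<j⇒i≤pred[j] (ℤ.≰⇒> 0≰c)

  mean≤-ε : s (suc t) * + suc L ≤ - 1ℤ * + suc t
  mean≤-ε = begin
    s (suc t) * + suc L          ≡⟨ cong (_* + suc L) (periodic (suc N)) ⟩
    + suc N * c * + suc L        ≤⟨ ℤ.*-monoʳ-≤-nonNeg (+ suc L) (ℤ.*-monoˡ-≤-nonNeg (+ suc N) c≤-1) ⟩
    + suc N * -1ℤ * + suc L      ≡⟨ cong (_* + suc L) (ℤ.*-comm (+ suc N) -1ℤ) ⟩
    -1ℤ * + suc N * + suc L      ≡⟨ ℤ.*-assoc -1ℤ (+ suc N) (+ suc L) ⟩
    -1ℤ * (+ suc N * + suc L)    ≡⟨ cong (-1ℤ *_) (ℤ.pos-* (suc N) (suc L)) ⟨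
    -1ℤ * + suc t                ∎

-- Graphs with one edge out of each vertex

module _ {n : ℕ} (f : Fin n → Fin n) where

  orbit : Fin n → ℕ → Fin n
  orbit u zero    = u
  orbit u (suc t) = f (orbit u t)

  orbit-+ : ∀ u s t → orbit u (t ℕ.+ s) ≡ orbit (orbit u s) t
  orbit-+ u s zero    = refl
  orbit-+ u s (suc t) = cong f (orbit-+ u s t)

  orbit-* : ∀ u L k → orbit u L ≡ u → orbit u (k ℕ.* L) ≡ u
  orbit-* u L zero    eq = refl
  orbit-* u L (suc k) eq = trans (orbit-+ u (k ℕ.* L) L)
    (trans (cong (λ x → orbit x L) (orbit-* u L k eq)) eq)

  module _ (g : Fin n → ℤ) where

    orbitWeight : Fin n → ℕ → ℤ
    orbitWeight u zero    = 0ℤ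
    orbitWeight u (suc t) = orbitWeight u t + g (orbit u t)

    orbitWeight-+ : ∀ u s t → orbitWeight u (t ℕ.+ s) ≡ orbitWeight u s + orbitWeight (orbit u s) t
    orbitWeight-+ u s zero    = sym (ℤ.+-identityʳ _)
    orbitWeight-+ u s (suc t) = begin
      orbitWeight u (t ℕ.+ s) + g (orbit u (t ℕ.+ s))
        ≡⟨ cong₂ _+_ (orbitWeight-+ u s t) (cong g (orbit-+ u s t)) ⟩
      orbitWeight u s + orbitWeight (orbit u s) t + g (orbit (orbit u s) t)
        ≡⟨ ℤ.+-assoc (orbitWeight u s) _ _ ⟩
      orbitWeight u s + (orbitWeight (orbit u s) t + g (orbit (orbit u s) t)) ∎
      where open ≡-Reasoning

    orbitWeight-suc : ∀ u t → orbitWeight u (suc t) ≡ g u + orbitWeight (f u) t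
    orbitWeight-suc u t = begin
      orbitWeight u (suc t)            ≡⟨ cong (orbitWeight u) (ℕ.+-comm 1 t) ⟩
      orbitWeight u (t ℕ.+ 1)          ≡⟨ orbitWeight-+ u 1 t ⟩
      0ℤ + g u + orbitWeight (f u) t   ≡⟨ cong (_+ orbitWeight (f u) t) (ℤ.+-identityˡ (g u)) ⟩
      g u + orbitWeight (f u) t        ∎
      where open ≡-Reasoning

    orbitWeight-* : ∀ u L k → orbit u L ≡ u → orbitWeight u (k ℕ.* L) ≡ + k * orbitWeight u L
    orbitWeight-* u L zero    eq = sym (ℤ.*-zeroˡ (orbitWeight u L))
    orbitWeight-* u L (suc k) eq = begin
      orbitWeight u (L ℕ.+ k ℕ.* L)
        ≡⟨ orbitWeight-+ u (k ℕ.* L) L ⟩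
      orbitWeight u (k ℕ.* L) + orbitWeight (orbit u (k ℕ.* L)) L
        ≡⟨ cong₂ _+_ (orbitWeight-* u L k eq) (cong (λ x → orbitWeight x L) (orbit-* u L k eq)) ⟩
      + k * c + c
        ≡⟨ ℤ.+-comm (+ k * c) c ⟩
      c + + k * c
        ≡⟨ ℤ.suc-* (+ k) c ⟨
      + suc k * c ∎
      where
      open ≡-Reasoning
      c = orbitWeight u L

    NonnegativeCycles : Set
    NonnegativeCycles = ∀ u L → orbit u (suc L) ≡ u → 0ℤ ≤ orbitWeight u (suc L)

    module _ (nonneg : NonnegativeCycles) where

      -- Cutting out the stretch from time `a` to time `b` removes a closed walk, of nonnegative
      -- weight, and leaves the last `r` steps as they are.
      orbitWeight-shortcut : ∀ u {a b} r → a ℕ.< b → orbit u a ≡ orbit u b →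
                             orbitWeight u (r ℕ.+ a) ≤ orbitWeight u (r ℕ.+ b)
      orbitWeight-shortcut u {a} {b} r a<b eq = begin
        orbitWeight u (r ℕ.+ a)                                      ≡⟨ orbitWeight-+ u a r ⟩
        orbitWeight u a + orbitWeight (orbit u a) r                  ≤⟨ ℤ.+-monoˡ-≤ _ a≤b ⟩
        orbitWeight u b + orbitWeight (orbit u a) r                  ≡⟨ cong (λ x → orbitWeight u b + orbitWeight x r) eq ⟩
        orbitWeight u b + orbitWeight (orbit u b) r                  ≡⟨ orbitWeight-+ u b r ⟨
        orbitWeight u (r ℕ.+ b)                                      ∎
        where
        open ℤ.≤-Reasoning
        d = b ℕ.∸ suc a
        b≡ : suc d ℕ.+ a ≡ b
        b≡ = trans (sym (ℕ.+-suc d a)) (ℕ.m∸n+n≡m a<b)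

        a≤b : orbitWeight u a ≤ orbitWeight u b
        a≤b = begin
          orbitWeight u a                                     ≡⟨ ℤ.+-identityʳ _ ⟨
          orbitWeight u a + 0ℤ                                ≤⟨ ℤ.+-monoʳ-≤ (orbitWeight u a) (nonneg (orbit u a) d
                                                                   (trans (sym (orbit-+ u a (suc d))) (trans (cong (orbit u) b≡) (sym eq)))) ⟩
          orbitWeight u a + orbitWeight (orbit u a) (suc d)   ≡⟨ orbitWeight-+ u a (suc d) ⟨
          orbitWeight u (suc d ℕ.+ a)                         ≡⟨ cong (orbitWeight u) b≡ ⟩
          orbitWeight u b                                     ∎

      -- The walks have lengths 0 to `n`; the default `0ℤ` adds no new value, being the weight of
      -- the empty walk.
      leastWeight : Fin n → ℤ
      leastWeight u = min 0ℤ (List.applyUpTo (orbitWeight u) (suc n))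

      leastWeight≤ : ∀ u {t} → t ℕ.≤ n → leastWeight u ≤ orbitWeight u t
      leastWeight≤ u t≤n = All.applyUpTo⁻ (orbitWeight u) (suc n) (min≤xs 0ℤ _) (s≤s t≤n)

      -- The positions at times 0 to `n` repeat a vertex; cutting out the cycle between two visits
      -- leaves at most `n` steps.
      leastWeight≤1+n : ∀ u → leastWeight u ≤ orbitWeight u (suc n)
      leastWeight≤1+n u with i , j , i<j , eq ← pigeonhole (ℕ.n<1+n n) (orbit u ∘ toℕ) = begin
        leastWeight u                                     ≤⟨ leastWeight≤ u (ℕ.s≤s⁻¹ (subst (r ℕ.+ toℕ i ℕ.<_) r+j (ℕ.+-monoʳ-< r i<j))) ⟩
        orbitWeight u (r ℕ.+ toℕ i)                       ≤⟨ orbitWeight-shortcut u r i<j eq ⟩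
        orbitWeight u (r ℕ.+ toℕ j)                       ≡⟨ cong (orbitWeight u) r+j ⟩
        orbitWeight u (suc n)                             ∎
        where
        open ℤ.≤-Reasoning
        r = suc n ℕ.∸ toℕ j
        r+j : r ℕ.+ toℕ j ≡ suc n
        r+j = ℕ.m∸n+n≡m (ℕ.<⇒≤ (toℕ<n j))

      -- Prefixing the edge out of `u` turns a walk from `f u` into one from `u` that is longer by
      -- one step.
      leastWeight-step : ∀ u → leastWeight u ≤ g u + leastWeight (f u)
      leastWeight-step u = begin
        leastWeight u                     ≡⟨ cancel (leastWeight u) (g u) ⟩
        g u + (leastWeight u - g u)       ≤⟨ ℤ.+-monoʳ-≤ (g u) (v≤min⁺ (lower ℕ.z≤n) (All.applyUpTo⁺₁ _ (suc n) λ t<1+n → lower (ℕ.s≤s⁻¹ t<1+n))) ⟩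
        g u + leastWeight (f u)           ∎
        where
        open ℤ.≤-Reasoning
        cancel : ∀ a b → a ≡ b + (a - b)
        cancel = solve-∀

        cancel′ : ∀ a b → b + a - b ≡ a
        cancel′ = solve-∀

        bound : ∀ {t} → t ℕ.≤ n → leastWeight u ≤ orbitWeight u (suc t)
        bound t≤n with ℕ.m≤n⇒m<n∨m≡n t≤n
        ... | inj₁ t<n  = leastWeight≤ u t<n
        ... | inj₂ refl = leastWeight≤1+n u

        lower : ∀ {t} → t ℕ.≤ n → leastWeight u - g u ≤ orbitWeight (f u) t
        lower {t} t≤n = begin
          leastWeight u - g u                 ≤⟨ ℤ.+-monoˡ-≤ (- g u) (bound t≤n) ⟩
          orbitWeight u (suc t) - g u         ≡⟨ cong (_- g u) (orbitWeight-suc u t) ⟩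
          g u + orbitWeight (f u) t - g u     ≡⟨ cancel′ (orbitWeight (f u) t) (g u) ⟩
          orbitWeight (f u) t                 ∎

-- Max-plus closed conditions on potentials

module _ {n : ℕ} where

  Potential : Set
  Potential = Fin n → ℤ

  -- Such sets are tropical cones: `⊔` is tropical addition, and adding `c` is multiplication by a
  -- scalar.
  record MaxPlusClosed (D : Pred Potential 0ℓ) : Set where
    field
      join  : ∀ {π ρ} → D π → D ρ → D (λ x → π x ⊔ ρ x)
      shift : ∀ {π} c → D π → D (λ x → c + π x)

  record LocalAt (u : Fin n) (A : Pred Potential 0ℓ) : Set where
    field
      raise : ∀ {π ρ} → (∀ x → π x ≤ ρ x) → π u ≡ ρ u → A π → A ρ
      shift : ∀ {π} c → A π → A (λ x → c + π x)

  open MaxPlusClosed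
  open LocalAt

  edge-local : ∀ c u x → LocalAt u (λ π → π u ≤ c + π x)
  edge-local c u x = record
    { raise = λ {π} {ρ} π≤ρ eq le → ℤ.≤-trans (ℤ.≤-reflexive (sym eq))
                (ℤ.≤-trans le (ℤ.+-monoʳ-≤ c (π≤ρ x)))
    ; shift = λ {π} d le → ℤ.≤-trans (ℤ.+-monoʳ-≤ d le) (ℤ.≤-reflexive (swap d c (π x)))
    }
    where
    swap : ∀ a b c → a + (b + c) ≡ b + (a + c)
    swap = solve-∀

  Π-local : ∀ {I : Set} {u} {A : I → Pred Potential 0ℓ} →
            (∀ i → LocalAt u (A i)) → LocalAt u (λ π → ∀ i → A i π)
  Π-local loc = record
    { raise = λ π≤ρ eq a i → raise (loc i) π≤ρ eq (a i)
    ; shift = λ c a i → shift (loc i) c (a i)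
    }

  -- `raise` and `shift` start from a single potential, so the disjunct it satisfies is kept. A join
  -- could mix two disjuncts, and `MaxPlusClosed` alone does not pass to disjunctions.
  Σ-local : ∀ {I : Set} {u} {A : I → Pred Potential 0ℓ} →
            (∀ i → LocalAt u (A i)) → LocalAt u (λ π → ∃ λ i → A i π)
  Σ-local loc = record
    { raise = λ { π≤ρ eq (i , a) → i , raise (loc i) π≤ρ eq a }
    ; shift = λ { c (i , a) → i , shift (loc i) c a }
    }

  -- The join agrees at `u` with the argument that is larger there, and raises it elsewhere.
  local⇒closed : ∀ {u A} → LocalAt u A → MaxPlusClosed A
  local⇒closed {u} {A} loc = record { join = join′ ; shift = shift loc }
    where
    join′ : ∀ {π ρ} → A π → A ρ → A (λ x → π x ⊔ ρ x)
    join′ {π} {ρ} a b with ℤ.≤-total (π u) (ρ u)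
    ... | inj₁ π≤ρ = raise loc (λ x → ℤ.i≤j⊔i (π x) (ρ x)) (sym (ℤ.i≤j⇒i⊔j≡j π≤ρ)) b
    ... | inj₂ ρ≤π = raise loc (λ x → ℤ.i≤i⊔j (π x) (ρ x)) (sym (ℤ.i≥j⇒i⊔j≡i ρ≤π)) a

  Π-closed : ∀ {I : Set} {D : I → Pred Potential 0ℓ} →
             (∀ i → MaxPlusClosed (D i)) → MaxPlusClosed (λ π → ∀ i → D i π)
  Π-closed clo = record
    { join  = λ a b i → join (clo i) (a i) (b i)
    ; shift = λ c a i → shift (clo i) c (a i)
    }

  ∩-closed : ∀ {D E : Pred Potential 0ℓ} → MaxPlusClosed D → MaxPlusClosed E → MaxPlusClosed (D ∩ E)
  ∩-closed D E = record
    { join  = λ { (d , e) (d′ , e′) → join D d d′ , join E e e′ }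
    ; shift = λ { c (d , e) → shift D c d , shift E c e }
    }

  combineAt : ∀ {k u D} {A : Fin k → Pred Potential 0ℓ} → MaxPlusClosed D → (∀ j → LocalAt u (A j)) →
              Satisfiable D → (∀ j → Satisfiable (D ∩ A j)) → Satisfiable (D ∩ λ π → ∀ j → A j π)
  combineAt {zero}  clo loc (π , d) sat = π , d , λ ()
  combineAt {suc k} {u} clo loc inh sat
    with π , d , a  ← sat zero
       | ρ , e , as ← combineAt clo (loc ∘ suc) inh (sat ∘ suc)
    = (λ x → π x ⊔ ρ′ x) , join clo d (shift clo c e) , λ
      { zero    → raise (loc zero) (λ x → ℤ.i≤i⊔j (π x) (ρ′ x)) (sym (ℤ.i≥j⇒i⊔j≡i (ℤ.≤-reflexive ρ′≡π))) a
      ; (suc j) → raise (loc (suc j)) (λ x → ℤ.i≤j⊔i (π x) (ρ′ x))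
                    (sym (ℤ.i≤j⇒i⊔j≡j (ℤ.≤-reflexive (sym ρ′≡π)))) (shift (loc (suc j)) c (as j))
      }
    where
    -- Shifting by `c` makes `ρ′` agree with `π` at `u`, so that their join raises both.
    c  = π u - ρ u
    ρ′ = λ x → c + ρ x
    cancel : ∀ a b → a - b + b ≡ a
    cancel = solve-∀
    ρ′≡π : ρ′ u ≡ π u
    ρ′≡π = cancel (π u) (ρ u)

  -- Induction on `m`, one vertex at a time: `combineAt` merges the conditions at the first vertex,
  -- with all others kept as part of the common condition. `P₀` ensures that there is a choice to
  -- start from.
  combine : ∀ {m} {u : Fin m → Fin n} {k : Fin m → ℕ} {D} {A : ∀ i → Fin (k i) → Pred Potential 0ℓ} →
            MaxPlusClosed D → (∀ i j → LocalAt (u i) (A i j)) → (∀ i → Fin (k i)) →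
            ((P : ∀ i → Fin (k i)) → Satisfiable (D ∩ λ π → ∀ i → A i (P i) π)) →
            Satisfiable (D ∩ λ π → ∀ i j → A i j π)
  combine {zero} clo loc P₀ sat with π , d , _ ← sat P₀ = π , d , λ ()
  combine {suc m} {k = k} {D} {A} clo loc P₀ sat
    = let π , (d , as) , a = combineAt rest-closed (loc zero) (map₂ proj₁ (forFirst (P₀ zero))) forFirst
      in π , d , λ { zero → a ; (suc i) → as i }
    where
    Rest : Pred Potential 0ℓ
    Rest = D ∩ λ π → ∀ i j → A (suc i) j π

    rest-closed : MaxPlusClosed Rest
    rest-closed = ∩-closed clo (Π-closed λ i → Π-closed λ j → local⇒closed (loc (suc i) j))

    forFirst : ∀ j → Satisfiable (Rest ∩ A zero j)
    -- For fixed `j` the condition at the first vertex is absorbed into `D`, and the recursion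
    -- treats the remaining vertices.
    forFirst j
      with π , (d , a) , as ← combine (∩-closed clo (local⇒closed (loc zero j))) (loc ∘ suc) (P₀ ∘ suc) (λ P →
             let π , d , as = sat (λ { zero → j ; (suc i) → P i })
             in π , (d , as zero) , as ∘ suc)
      = π , (d , as) , a

-- Strategies and potentials

module _ (G : MeanPayoffGame) where
  open MeanPayoffGame G
  open Play

  Allowed : Vec (Fin n) m → Fin n → Fin n → Set
  Allowed σ u u′ = ∀ i → u ≡ v i → u′ ≡ lookup σ i

  IsPotential : Vec (Fin n) m → Pred (Fin n → ℤ) 0ℓ
  IsPotential σ π = ∀ {u u′} (e : u′ ∈ N⁺ u) → Allowed σ u u′ → π u ≤ w e + π u′

  allowed? : ∀ σ u → Decidable (Allowed σ u)
  allowed? σ u u′ = all? λ i → (u ≟ v i) →-dec (u′ ≟ lookup σ i)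

  w-irrelevant : ∀ {u u′} (e e′ : u′ ∈ N⁺ u) → w e ≡ w e′
  w-irrelevant e e′ = cong w ([]=-irrelevant e e′)

  potential⇒winning : ∀ {σ π} → ∏ (strategySets G) σ → IsPotential σ π → Winning G σ
  potential⇒winning {σ} {π} σ∈U pot = σ∈U , λ p follows →
    bounded⇒0≤liminf-mean (totalWeight p) (π (position p 0) - top) (bounded p follows)
    where
    open ℤ.≤-Reasoning
    top : ℤ
    top = max 0ℤ (List.map π (List.allFin n))

    ≤top : ∀ u → π u ≤ top
    ≤top u = All.lookup (All.map⁻ (xs≤max 0ℤ (List.map π (List.allFin n)))) (∈-allFin u)

    telescope : ∀ p → Follows p σ → ∀ t → π (position p 0) ≤ totalWeight p t + π (position p t)
    telescope p follows zero    = ℤ.≤-reflexive (sym (ℤ.+-identityˡ _))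
    telescope p follows (suc t) = begin
      π (position p 0)                                              ≤⟨ telescope p follows t ⟩
      totalWeight p t + π (position p t)                            ≤⟨ ℤ.+-monoʳ-≤ (totalWeight p t) (pot (move p t) (follows t)) ⟩
      totalWeight p t + (w (move p t) + π (position p (suc t)))     ≡⟨ ℤ.+-assoc (totalWeight p t) _ _ ⟨
      totalWeight p (suc t) + π (position p (suc t))                ∎

    bounded : ∀ p → Follows p σ → ∀ t → π (position p 0) - top ≤ totalWeight p t
    bounded p follows t = begin
      π (position p 0) - top                              ≤⟨ ℤ.+-mono-≤ (telescope p follows t) (ℤ.neg-mono-≤ (≤top (position p t))) ⟩
      totalWeight p t + π (position p t) - π (position p t) ≡⟨ cancel (totalWeight p t) (π (position p t)) ⟩
      totalWeight p t                                     ∎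
      where
      cancel : ∀ a b → a + b - b ≡ a
      cancel = solve-∀

  module _ {σ} (winning : Winning G σ) where

    module _ (f : Fin n → Fin n) (f-edge : ∀ u → f u ∈ N⁺ u) (f-allowed : ∀ u → Allowed σ u (f u)) where

      g : Fin n → ℤ
      g u = w (f-edge u)

      orbitPlay : Fin n → Play G
      orbitPlay u = record { position = orbit f u ; move = λ t → f-edge (orbit f u t) }

      totalWeight≡orbitWeight : ∀ u t → totalWeight (orbitPlay u) t ≡ orbitWeight f g u t
      totalWeight≡orbitWeight u zero    = refl
      totalWeight≡orbitWeight u (suc t) = cong (_+ g (orbit f u t)) (totalWeight≡orbitWeight u t)

      -- Going round the cycle forever is a play that follows `σ` and gains the weight of the cycle
      -- in every round.
      winning⇒nonnegativeCycles : NonnegativeCycles f g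
      winning⇒nonnegativeCycles u L cycle = 0≤liminf-mean⇒0≤period (totalWeight (orbitPlay u)) L _
        (λ k → trans (totalWeight≡orbitWeight u (k ℕ.* suc L)) (orbitWeight-* f g u (suc L) k cycle))
        (proj₂ winning (orbitPlay u) (λ t → f-allowed (orbit f u t)))

      orbitPotential : Fin n → ℤ
      orbitPotential = leastWeight f g winning⇒nonnegativeCycles

      orbitPotential-edge : ∀ {u u′} → f u ≡ u′ → (e : u′ ∈ N⁺ u) → orbitPotential u ≤ w e + orbitPotential u′
      orbitPotential-edge {u} refl e = subst (λ c → orbitPotential u ≤ c + orbitPotential (f u))
        (w-irrelevant (f-edge u) e) (leastWeight-step f g winning⇒nonnegativeCycles u)

    allowedEdge : ∀ u → ∃ λ u′ → u′ ∈ N⁺ u × Allowed σ u u′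
    allowedEdge u with any? (λ i → u ≟ v i)
    ... | yes (i , refl) = lookup σ i , proj₁ winning i , λ j vi≡vj → cong (lookup σ) (v-injective vi≡vj)
    ... | no  u∉V        = let u′ , e = N⁺-nonempty u in u′ , e , λ i u≡vi → contradiction (i , u≡vi) u∉V

    winning⇒potential : Satisfiable (IsPotential σ)
    winning⇒potential =
      -- The common condition is trivial, the indices at a vertex are its candidate successors, and
      -- `id` is an arbitrary choice.
      let π , _ , pot = combine {D = U} record { join = λ _ _ → tt ; shift = λ _ _ → tt } local id functional
      in π , λ {u} {u′} → pot u u′
      where
      Edge : Fin n → Fin n → Pred (Fin n → ℤ) 0ℓ
      Edge u u′ π = (e : u′ ∈ N⁺ u) → Allowed σ u u′ → π u ≤ w e + π u′

      local : ∀ u u′ → LocalAt u (Edge u u′)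
      local u u′ = Π-local λ e → Π-local λ _ → edge-local (w e) u u′

      functional : (P : Fin n → Fin n) → Satisfiable (U ∩ λ π → ∀ u → Edge u (P u) π)
      functional P = orbitPotential f f-edge f-allowed , tt , λ u e a →
        orbitPotential-edge f f-edge f-allowed (proj₂ (proj₂ (choice u)) e a) e
        where
        -- `P` may propose a non-edge or a move that `σ` forbids. Its condition is then vacuous, and
        -- any allowed edge can stand in.
        choice : ∀ u → ∃ λ u′ → (u′ ∈ N⁺ u × Allowed σ u u′) × (P u ∈ N⁺ u → Allowed σ u (P u) → u′ ≡ P u)
        choice u with (P u ∈? N⁺ u) ×-dec allowed? σ u (P u)
        ... | yes ok = P u , ok , λ _ _ → refl
        ... | no ¬ok = let u′ , ok = allowedEdge u in u′ , ok , λ e a → contradiction (e , a) ¬ok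

        f         = λ u → proj₁ (choice u)
        f-edge    = λ u → proj₁ (proj₁ (proj₂ (choice u)))
        f-allowed = λ u → proj₂ (proj₁ (proj₂ (choice u)))

-- Copies of minor-subproducts

image : ∀ {k n} → (Fin k → Fin n) → Subset n
image r = tabulate λ x → does (any? λ j → r j ≟ x)

∈-image⁺ : ∀ {k n} (r : Fin k → Fin n) j → r j ∈ image r
∈-image⁺ r j = lookup⇒[]= _ _ (trans (lookup∘tabulate _ (r j)) (dec-true (any? λ j′ → r j′ ≟ r j) (j , refl)))

∈-image⁻ : ∀ {k n} (r : Fin k → Fin n) {x} → x ∈ image r → ∃ λ j → r j ≡ x
∈-image⁻ r {x} x∈ with any? (λ j → r j ≟ x) | trans (sym (lookup∘tabulate (λ x → does (any? λ j → r j ≟ x)) x)) ([]=⇒lookup x∈)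
... | yes hit | _  = hit
... | no  _   | ()

-- Uniqueness rests on disjointness: a representative lying in block `j` can only be the one chosen
-- for `j`.
image-isCopy : ∀ {m n} {U : Fin m → Subset n} (Λ : GeneralizedPartition U) (r : ∀ i → Fin (size (Λ i)) → Fin n) →
               (∀ i j → r i j ∈ block (Λ i) j) → IsCopy Λ (image ∘ r)
image-isCopy {U = U} Λ r r∈ i = sub , λ j → r i j , (∈-image⁺ (r i) j , r∈ i j) , λ {(x∈ , x∈B) → unique x∈ x∈B}
  where
  sub : ∀ {x} → x ∈ image (r i) → x ∈ U i
  sub x∈ with j , refl ← ∈-image⁻ (r i) x∈ = from (covers (Λ i) _) (j , r∈ i j)

  unique : ∀ {j x} → x ∈ image (r i) → x ∈ block (Λ i) j → r i j ≡ x
  unique x∈ x∈B with j′ , refl ← ∈-image⁻ (r i) x∈ = cong (r i) (disjoint (Λ i) x∈B (r∈ i j′))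

theorem16 : (G : MeanPayoffGame) → Ample (strategySets G) (Winning G)
theorem16 G = proj₁ , stronglyShattered
  where
  open MeanPayoffGame G

  module _ (Λ : GeneralizedPartition (strategySets G)) (shattered : Shattered Λ (Winning G)) where

    inU : ∀ {i j x} → x ∈ block (Λ i) j → x ∈ N⁺ (v i)
    inU {i} {j} {x} x∈B = from (covers (Λ i) x) (j , x∈B)

    -- The condition common to all boxes, since Minimizer's edges remain whatever `σ` is.
    MinimizerEdges : Pred (Fin n → ℤ) 0ℓ
    MinimizerEdges π = ∀ u u′ (e : u′ ∈ N⁺ u) → (∀ i → u ≢ v i) → π u ≤ w e + π u′

    SomeEdgeInto : ∀ i → Fin (size (Λ i)) → Pred (Fin n → ℤ) 0ℓ
    SomeEdgeInto i j π = Σ (∃ λ x → x ∈ block (Λ i) j) λ (x , x∈B) → π (v i) ≤ w (inU x∈B) + π x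

    minimizerEdges-closed : MaxPlusClosed MinimizerEdges
    minimizerEdges-closed = Π-closed λ u → local⇒closed $ Π-local λ u′ → Π-local λ e → Π-local λ _ → edge-local (w e) u u′

    someEdgeInto-local : ∀ i j → LocalAt (v i) (SomeEdgeInto i j)
    someEdgeInto-local i j = Σ-local λ (x , x∈B) → edge-local (w (inU x∈B)) (v i) x

    anyBlock : ∀ i → Fin (size (Λ i))
    anyBlock i = let x , x∈U = N⁺-nonempty (v i) in proj₁ (to (covers (Λ i) x) x∈U)

    -- Shattering supplies a winning strategy in the box. Its move at `v i` is the witness in block
    -- `P i`, and injectivity of `v` makes that edge allowed.
    boxPotential : (P : MinorSubproduct Λ) → Satisfiable (MinimizerEdges ∩ λ π → ∀ i → SomeEdgeInto i (P i) π)
    boxPotential P =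
      let σ , winning , σ∈box = shattered P
          π , pot = winning⇒potential G {σ} winning
      in π , (λ u u′ e u∉V → pot e λ i u≡vi → contradiction u≡vi (u∉V i))
          , λ i → (lookup σ i , σ∈box i) , pot (inU (σ∈box i)) λ j vi≡vj → cong (lookup σ) (v-injective vi≡vj)

    module Representatives {π} (minEdges : MinimizerEdges π) (maxEdges : ∀ i j → SomeEdgeInto i j π) where

      r : ∀ i → Fin (size (Λ i)) → Fin n
      r i j = proj₁ (proj₁ (maxEdges i j))

      copy : IsCopy Λ (image ∘ r)
      copy = image-isCopy Λ r λ i j → proj₂ (proj₁ (maxEdges i j))

      -- At `v i` every `σ` from the copy moves to some `r i j`, for which `π` already satisfies the
      -- inequality, so one `π` serves the whole copy.
      isPotential : ∀ {σ} → ∏ (image ∘ r) σ → IsPotential G σ π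
      isPotential {σ} σ∈W {u} {u′} e allowed with any? (λ i → u ≟ v i)
      ... | no  u∉V        = minEdges u u′ e λ i u≡vi → u∉V (i , u≡vi)
      ... | yes (i , refl) with j , rj≡σi ← ∈-image⁻ (r i) (σ∈W i)
                           with refl ← trans (allowed i refl) (sym rj≡σi)
        = subst (λ c → π (v i) ≤ c + π (r i j)) (w-irrelevant G (inU (proj₂ (proj₁ (maxEdges i j)))) e) (proj₂ (maxEdges i j))

    stronglyShattered : StronglyShattered Λ (Winning G)
    stronglyShattered =
      let π , minEdges , maxEdges = combine {u = v} {D = MinimizerEdges} {A = SomeEdgeInto}
                                      minimizerEdges-closed someEdgeInto-local anyBlock boxPotential
          open Representatives minEdges maxEdges
      in image ∘ r , copy , λ {σ} σ∈W →
           potential⇒winning G {σ} (λ i → proj₁ (copy i) (σ∈W i)) (isPotential {σ} σ∈W)
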